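{- Let $G_1$ and $G_2$ be two vertex-disjoint simple connected graphs with $|V(G_1)|=n_1$, $|V(G_2)|=n_2$, $|E(G_1)|=m_1$, $|E(G_2)|=m_2$. Then the vertex S-join $G_1\dot{\vee}_S G_2$ satisfies \[ F(G_1\dot{\vee}_S G_2)=F(G_1)+F(G_2)+3n_2M_1(G_1)+3n_1M_1(G_2)+6m_1n_2^{2}+6m_2n_1^{2}+n_1n_2(n_1^2+n_2^2)+8m_1 . \]
   Context: For a simple graph $G$ and $v\in V(G)$, $d_G(v)$ is the degree of $v$. The first Zagreb index is $M_1(G)=\sum_{v\in V(G)}d_G(v)^2$ and the F-index (forgotten topological index) is $F(G)=\sum_{v\in V(G)}d_G(v)^3$. The subdivision graph $S(G)$ is obtained from $G$ by inserting a new vertex into each edge of $G$ (replacing each edge by a path of length 2); let $I(G)$ denote the set of these inserted vertices, so $V(S(G))=V(G)\cup I(G)$. The vertex S-join $G_1\dot{\vee}_S G_2$ is the graph obtained from $S(G_1)$ and $G_2$ (taken vertex-disjoint) by joining each vertex of $V(G_1)$ to every vertex of $G_2$ by an edge. -}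

module Defs where

open import Data.Empty using (⊥)
open import Data.Fin using (Fin; _<_)
open import Data.Fin.Properties using (_≟_; _<?_; +↔⊎)
open import Data.List using (List; tabulate; filter; length; lookup; map; cartesianProduct)
open import Data.Nat using (ℕ; _+_; _^_)
open import Data.Nat.ListAction using (sum)
open import Data.Product using (_×_; _,_; proj₁; proj₂)
open import Data.Sum using (_⊎_; inj₁; inj₂)
open import Data.Sum.Function.Propositional using (_⊎-↔_)
open import Data.Unit using (⊤; tt)
open import Function.Bundles using (_↔_; Inverse)
open import Function.Properties.Inverse using (↔-sym; ↔-trans; ↔-refl; Inverse⇒Injection)
open import Relation.Binary.Construct.Closure.ReflexiveTransitive using (Star)
open import Relation.Binary.Definitions using (Decidable; DecidableEquality; Irreflexive; Symmetric)
open import Relation.Binary.PropositionalEquality using (_≡_; refl)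
open import Relation.Nullary using (Dec; yes; no)
open import Relation.Nullary.Decidable using (_×-dec_; _⊎-dec_; via-injection)

record Graph : Set₁ where
  field
    V           : Set
    order       : ℕ
    enumeration : V ↔ Fin order
    Adj         : V → V → Set
    Adj?        : Decidable Adj
    Adj-sym     : Symmetric Adj
    Adj-irrefl  : Irreflexive _≡_ Adj

  index : V → Fin order
  index = Inverse.to enumeration

  vertices : List V
  vertices = tabulate (Inverse.from enumeration)

  _≟ᵛ_ : DecidableEquality V
  _≟ᵛ_ = via-injection (Inverse⇒Injection enumeration) _≟_

  deg : V → ℕ
  deg v = length (filter (Adj? v) vertices)

  -- Each edge {u , v} is listed exactly once, as the pair whose first
  -- component comes first in the enumeration.
  IsEdge : V × V → Set
  IsEdge (u , v) = index u < index v × Adj u v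

  isEdge? : (p : V × V) → Dec (IsEdge p)
  isEdge? (u , v) = (index u <? index v) ×-dec Adj? u v

  edges : List (V × V)
  edges = filter isEdge? (cartesianProduct vertices vertices)

  size : ℕ
  size = length edges

  Edge : Set
  Edge = Fin size

  Incident : V → Edge → Set
  Incident v e = v ≡ proj₁ (lookup edges e) ⊎ v ≡ proj₂ (lookup edges e)

  incident? : Decidable Incident
  incident? v e = (v ≟ᵛ proj₁ (lookup edges e)) ⊎-dec (v ≟ᵛ proj₂ (lookup edges e))

open Graph

-- The graph with no vertices is not considered connected.
Connected : Graph → Set
Connected G = V G × (∀ u v → Star (Adj G) u v)

M₁ : Graph → ℕ
M₁ G = sum (map (λ v → deg G v ^ 2) (vertices G))

F : Graph → ℕ
F G = sum (map (λ v → deg G v ^ 3) (vertices G))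

⊎-enumeration : ∀ {A B : Set} {m n} → A ↔ Fin m → B ↔ Fin n → (A ⊎ B) ↔ Fin (m + n)
⊎-enumeration A↔ B↔ = ↔-trans (A↔ ⊎-↔ B↔) (↔-sym +↔⊎)

module _ (G : Graph) where

  SubdivisionAdj : V G ⊎ Edge G → V G ⊎ Edge G → Set
  SubdivisionAdj (inj₁ _) (inj₁ _) = ⊥
  SubdivisionAdj (inj₁ v) (inj₂ e) = Incident G v e
  SubdivisionAdj (inj₂ e) (inj₁ v) = Incident G v e
  SubdivisionAdj (inj₂ _) (inj₂ _) = ⊥

  subdivisionAdj? : Decidable SubdivisionAdj
  subdivisionAdj? (inj₁ _) (inj₁ _) = no λ ()
  subdivisionAdj? (inj₁ v) (inj₂ e) = incident? G v e
  subdivisionAdj? (inj₂ e) (inj₁ v) = incident? G v e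
  subdivisionAdj? (inj₂ _) (inj₂ _) = no λ ()

  subdivisionAdj-sym : Symmetric SubdivisionAdj
  subdivisionAdj-sym {inj₁ _} {inj₂ _} p = p
  subdivisionAdj-sym {inj₂ _} {inj₁ _} p = p

  subdivisionAdj-irrefl : Irreflexive _≡_ SubdivisionAdj
  subdivisionAdj-irrefl {inj₁ _} refl ()
  subdivisionAdj-irrefl {inj₂ _} refl ()

  -- The inserted vertices I(G) are the right summand.
  subdivision : Graph
  subdivision = record
    { V           = V G ⊎ Edge G
    ; order       = order G + size G
    ; enumeration = ⊎-enumeration (enumeration G) ↔-refl
    ; Adj         = SubdivisionAdj
    ; Adj?        = subdivisionAdj?
    ; Adj-sym     = λ {x} {y} → subdivisionAdj-sym {x} {y}
    ; Adj-irrefl  = subdivisionAdj-irrefl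
    }

module _ (G₁ G₂ : Graph) where

  JoinAdj : V (subdivision G₁) ⊎ V G₂ → V (subdivision G₁) ⊎ V G₂ → Set
  JoinAdj (inj₁ x)        (inj₁ y)        = Adj (subdivision G₁) x y
  JoinAdj (inj₁ (inj₁ _)) (inj₂ _)        = ⊤
  JoinAdj (inj₁ (inj₂ _)) (inj₂ _)        = ⊥
  JoinAdj (inj₂ _)        (inj₁ (inj₁ _)) = ⊤
  JoinAdj (inj₂ _)        (inj₁ (inj₂ _)) = ⊥
  JoinAdj (inj₂ x)        (inj₂ y)        = Adj G₂ x y

  joinAdj? : Decidable JoinAdj
  joinAdj? (inj₁ x)        (inj₁ y)        = Adj? (subdivision G₁) x y
  joinAdj? (inj₁ (inj₁ _)) (inj₂ _)        = yes tt
  joinAdj? (inj₁ (inj₂ _)) (inj₂ _)        = no λ ()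
  joinAdj? (inj₂ _)        (inj₁ (inj₁ _)) = yes tt
  joinAdj? (inj₂ _)        (inj₁ (inj₂ _)) = no λ ()
  joinAdj? (inj₂ x)        (inj₂ y)        = Adj? G₂ x y

  joinAdj-sym : Symmetric JoinAdj
  joinAdj-sym {inj₁ x}        {inj₁ y}        p = Adj-sym (subdivision G₁) {x} {y} p
  joinAdj-sym {inj₁ (inj₁ _)} {inj₂ _}        p = p
  joinAdj-sym {inj₂ _}        {inj₁ (inj₁ _)} p = p
  joinAdj-sym {inj₂ _}        {inj₂ _}        p = Adj-sym G₂ p

  joinAdj-irrefl : Irreflexive _≡_ JoinAdj
  joinAdj-irrefl {inj₁ x} refl = Adj-irrefl (subdivision G₁) {x} refl
  joinAdj-irrefl {inj₂ _} refl = Adj-irrefl G₂ refl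

  vertexSJoin : Graph
  vertexSJoin = record
    { V           = V (subdivision G₁) ⊎ V G₂
    ; order       = order (subdivision G₁) + order G₂
    ; enumeration = ⊎-enumeration (enumeration (subdivision G₁)) (enumeration G₂)
    ; Adj         = JoinAdj
    ; Adj?        = joinAdj?
    ; Adj-sym     = λ {x} {y} → joinAdj-sym {x} {y}
    ; Adj-irrefl  = λ {x} {y} → joinAdj-irrefl {x} {y}
    }

{-# OPTIONS --safe #-}

-- In the join a vertex v of G₁ has degree d(v) + n₂, an inserted vertex has
-- degree 2, and a vertex w of G₂ has degree d(w) + n₁.  Summing the cubes and
-- expanding them, the terms linear in the degrees are evaluated by the
-- handshake lemma Σ d(v) = 2m, and the m₁ inserted vertices contribute 8m₁.
module Submission where

open import Defs
open import Data.Bool using (if_then_else_; true; false)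
open import Data.Fin using (Fin; zero; suc; _↑ˡ_; _↑ʳ_)
open import Data.Fin.Properties using (splitAt-↑ˡ; splitAt-↑ʳ; <-cmp; <-asym; <-irrefl)
open import Data.List using (List; []; _∷_; _++_; map; tabulate; allFin; filter; length; lookup; cartesianProduct)
open import Data.List.Membership.Propositional using (_∈_)
open import Data.List.Membership.Propositional.Properties using (∈-tabulate⁺; ∈-lookup)
open import Data.List.Properties using (map-++; map-∘; map-cong; map-tabulate; tabulate-cong; tabulate-lookup; length-tabulate)
open import Data.List.Relation.Unary.All as All using (All; []; _∷_)
open import Data.List.Relation.Unary.All.Properties using (all-filter)
open import Data.List.Relation.Unary.AllPairs using (_∷_)
open import Data.List.Relation.Unary.Any using (here; there)
open import Data.List.Relation.Unary.Unique.Propositional using (Unique)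
open import Data.List.Relation.Unary.Unique.Propositional.Properties using (tabulate⁺)
open import Data.Nat using (ℕ; zero; suc; _+_; _*_; _^_)
open import Data.Nat.ListAction using (sum)
open import Data.Nat.ListAction.Properties using (sum-++)
open import Data.Nat.Properties using (+-comm; +-identityʳ; *-comm; *-identityʳ; *-zeroʳ; *-distribˡ-+; *-distribʳ-+; +-commutativeSemigroup)
open import Algebra.Properties.CommutativeSemigroup +-commutativeSemigroup using (interchange)
open import Data.Nat.Tactic.RingSolver using (solve-∀)
open import Data.Product using (_×_; _,_; proj₁; proj₂)
open import Data.Sum using (_⊎_; inj₁; inj₂)
open import Function using (_∘_; id)
open import Function.Bundles using (_↔_; _⇔_; mk⇔; module Injection; module Inverse)
open import Function.Properties.Inverse using (↔-sym; ↔-refl; Inverse⇒Injection)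
open import Level using (Level)
open import Relation.Binary.Definitions using (DecidableEquality; tri<; tri≈; tri>)
open import Relation.Binary.PropositionalEquality using (_≡_; _≢_; refl; sym; trans; cong; cong₂; subst; module ≡-Reasoning)
open import Relation.Nullary using (Dec; yes; no; does; ¬_; contradiction)
open import Relation.Nullary.Decidable using (dec-true; dec-false; does-⇔; _⊎-dec_)
open import Relation.Unary using (Pred; Decidable)

open ≡-Reasoning

private
  variable
    a p q : Level
    A B : Set a
    P : Set p
    Q : Set q
    m n : ℕ

-- Finite sums over lists.

∑ : List A → (A → ℕ) → ℕ
∑ xs f = sum (map f xs)

∑-cong : ∀ {f g : A → ℕ} → (∀ x → f x ≡ g x) → ∀ xs → ∑ xs f ≡ ∑ xs g
∑-cong f≗g xs = cong sum (map-cong f≗g xs)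

∑-++ : ∀ (f : A → ℕ) xs ys → ∑ (xs ++ ys) f ≡ ∑ xs f + ∑ ys f
∑-++ f xs ys = trans (cong sum (map-++ f xs ys)) (sum-++ (map f xs) (map f ys))

∑-map : ∀ (g : A → B) (f : B → ℕ) xs → ∑ (map g xs) f ≡ ∑ xs (f ∘ g)
∑-map g f xs = cong sum (sym (map-∘ xs))

∑-const : ∀ (xs : List A) c → ∑ xs (λ _ → c) ≡ length xs * c
∑-const []       c = refl
∑-const (_ ∷ xs) c = cong (c +_) (∑-const xs c)

∑-zero : ∀ (xs : List A) → ∑ xs (λ _ → 0) ≡ 0
∑-zero xs = trans (∑-const xs 0) (*-zeroʳ (length xs))

∑-+ : ∀ (f g : A → ℕ) xs → ∑ xs (λ x → f x + g x) ≡ ∑ xs f + ∑ xs g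
∑-+ f g []       = refl
∑-+ f g (x ∷ xs) = begin
  f x + g x + ∑ xs (λ y → f y + g y)  ≡⟨ cong (f x + g x +_) (∑-+ f g xs) ⟩
  f x + g x + (∑ xs f + ∑ xs g)       ≡⟨ interchange (f x) (g x) (∑ xs f) (∑ xs g) ⟩
  f x + ∑ xs f + (g x + ∑ xs g)       ∎

∑-*ˡ : ∀ c (f : A → ℕ) xs → ∑ xs (λ x → c * f x) ≡ c * ∑ xs f
∑-*ˡ c f []       = sym (*-zeroʳ c)
∑-*ˡ c f (x ∷ xs) = trans (cong (c * f x +_) (∑-*ˡ c f xs)) (sym (*-distribˡ-+ c (f x) (∑ xs f)))

∑-comm : ∀ (f : A → B → ℕ) xs ys → ∑ xs (λ x → ∑ ys (f x)) ≡ ∑ ys (λ y → ∑ xs (λ x → f x y))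
∑-comm f []       ys = sym (∑-zero ys)
∑-comm f (x ∷ xs) ys = trans (cong (∑ ys (f x) +_) (∑-comm f xs ys))
                             (sym (∑-+ (f x) (λ y → ∑ xs (λ z → f z y)) ys))

∑-cartesianProduct : ∀ (f : A × B → ℕ) xs ys →
  ∑ (cartesianProduct xs ys) f ≡ ∑ xs (λ x → ∑ ys (λ y → f (x , y)))
∑-cartesianProduct f []       ys = refl
∑-cartesianProduct f (x ∷ xs) ys = begin
  ∑ (map (x ,_) ys ++ cartesianProduct xs ys) f
    ≡⟨ ∑-++ f (map (x ,_) ys) (cartesianProduct xs ys) ⟩
  ∑ (map (x ,_) ys) f + ∑ (cartesianProduct xs ys) f
    ≡⟨ cong₂ _+_ (∑-map (x ,_) f ys) (∑-cartesianProduct f xs ys) ⟩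
  ∑ ys (λ y → f (x , y)) + ∑ xs (λ z → ∑ ys (λ y → f (z , y)))
    ∎

-- An `Edge` is a position in the list `edges`; this lets a sum over positions be computed on the
-- listed pairs of vertices.
∑-lookup : ∀ (xs : List A) (f : A → ℕ) → ∑ (allFin (length xs)) (f ∘ lookup xs) ≡ ∑ xs f
∑-lookup xs f = begin
  ∑ (allFin (length xs)) (f ∘ lookup xs)  ≡⟨ ∑-map (lookup xs) f (allFin (length xs)) ⟨
  ∑ (map (lookup xs) (allFin _)) f        ≡⟨ cong (λ ys → ∑ ys f) (map-tabulate id (lookup xs)) ⟩
  ∑ (tabulate (lookup xs)) f              ≡⟨ cong (λ ys → ∑ ys f) (tabulate-lookup xs) ⟩
  ∑ xs f                                  ∎

length-allFin : ∀ n → length (allFin n) ≡ n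
length-allFin n = length-tabulate {n = n} id

-- Indicators of decidable propositions, counting and delta sums.

𝟙 : Dec P → ℕ
𝟙 P? = if does P? then 1 else 0

𝟙-true : (P? : Dec P) → P → 𝟙 P? ≡ 1
𝟙-true P? p = cong (if_then 1 else 0) (dec-true P? p)

𝟙-false : (P? : Dec P) → ¬ P → 𝟙 P? ≡ 0
𝟙-false P? ¬p = cong (if_then 1 else 0) (dec-false P? ¬p)

𝟙-⇔ : P ⇔ Q → (P? : Dec P) (Q? : Dec Q) → 𝟙 P? ≡ 𝟙 Q?
𝟙-⇔ P⇔Q P? Q? = cong (if_then 1 else 0) (does-⇔ P⇔Q P? Q?)

𝟙-⊎ : (P? : Dec P) (Q? : Dec Q) → ¬ (P × Q) → 𝟙 (P? ⊎-dec Q?) ≡ 𝟙 P? + 𝟙 Q?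
𝟙-⊎ (yes p) (yes q) ¬pq = contradiction (p , q) ¬pq
𝟙-⊎ (yes _) (no _)  _   = refl
𝟙-⊎ (no _)  (yes _) _   = refl
𝟙-⊎ (no _)  (no _)  _   = refl

length-filter-𝟙 : ∀ {P : Pred A p} (P? : Decidable P) xs → length (filter P? xs) ≡ ∑ xs (𝟙 ∘ P?)
length-filter-𝟙 P? []       = refl
length-filter-𝟙 P? (x ∷ xs) with does (P? x)
... | true  = cong suc (length-filter-𝟙 P? xs)
... | false = length-filter-𝟙 P? xs

∑-filter : ∀ {P : Pred A p} (P? : Decidable P) (f : A → ℕ) xs →
  ∑ (filter P? xs) f ≡ ∑ xs (λ x → 𝟙 (P? x) * f x)
∑-filter P? f []       = refl
∑-filter P? f (x ∷ xs) with does (P? x)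
... | true  = cong₂ _+_ (sym (+-identityʳ (f x))) (∑-filter P? f xs)
... | false = ∑-filter P? f xs

module _ {A : Set a} (_≟_ : DecidableEquality A) (f : A → ℕ) where

  ∑-δ-∉ : ∀ {v xs} → All (v ≢_) xs → ∑ xs (λ x → 𝟙 (v ≟ x) * f x) ≡ 0
  ∑-δ-∉ []                         = refl
  ∑-δ-∉ {v} {x ∷ _} (v≢x ∷ v∉xs) = cong₂ _+_ (cong (_* f x) (𝟙-false (v ≟ x) v≢x)) (∑-δ-∉ v∉xs)

  -- Membership supplies one term equal to `f v`; uniqueness makes the indicator vanish at every
  -- other position.
  ∑-δ : ∀ {v xs} → Unique xs → v ∈ xs → ∑ xs (λ x → 𝟙 (v ≟ x) * f x) ≡ f v
  ∑-δ {v} {_ ∷ xs} (v∉xs ∷ _) (here refl) = begin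
    𝟙 (v ≟ v) * f v + ∑ xs _  ≡⟨ cong₂ _+_ (cong (_* f v) (𝟙-true (v ≟ v) refl)) (∑-δ-∉ v∉xs) ⟩
    f v + 0 + 0               ≡⟨ trans (+-identityʳ _) (+-identityʳ _) ⟩
    f v                       ∎
  ∑-δ {v} {x ∷ xs} (x∉xs ∷ xs!) (there v∈xs) =
    cong₂ _+_ (cong (_* f x) (𝟙-false (v ≟ x) λ { refl → All.lookup x∉xs v∈xs refl })) (∑-δ xs! v∈xs)

-- Sums over a disjoint union.

tabulate-+ : ∀ m (f : Fin (m + n) → A) →
  tabulate f ≡ tabulate (f ∘ (_↑ˡ n)) ++ tabulate (f ∘ (m ↑ʳ_))
tabulate-+ zero    f = refl
tabulate-+ (suc m) f = cong (f zero ∷_) (tabulate-+ m (f ∘ suc))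

-- The combined enumeration decodes an index by `splitAt`, so its first `m` entries run through the
-- left summand and the remaining `n` through the right one.
∑-⊎ : ∀ {A B : Set} (A↔ : A ↔ Fin m) (B↔ : B ↔ Fin n) (f : A ⊎ B → ℕ) →
  ∑ (tabulate (Inverse.from (⊎-enumeration A↔ B↔))) f
    ≡ ∑ (tabulate (Inverse.from A↔)) (f ∘ inj₁) + ∑ (tabulate (Inverse.from B↔)) (f ∘ inj₂)
∑-⊎ {m} {n} A↔ B↔ f = begin
  ∑ (tabulate from) f
    ≡⟨ cong (λ xs → ∑ xs f) (tabulate-+ m from) ⟩
  ∑ (tabulate (from ∘ (_↑ˡ n)) ++ tabulate (from ∘ (m ↑ʳ_))) f
    ≡⟨ ∑-++ f (tabulate (from ∘ (_↑ˡ n))) _ ⟩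
  ∑ (tabulate (from ∘ (_↑ˡ n))) f + ∑ (tabulate (from ∘ (m ↑ʳ_))) f
    ≡⟨ cong₂ (λ xs ys → ∑ xs f + ∑ ys f) (tabulate-cong fromˡ) (tabulate-cong fromʳ) ⟩
  ∑ (tabulate (inj₁ ∘ Inverse.from A↔)) f + ∑ (tabulate (inj₂ ∘ Inverse.from B↔)) f
    ≡⟨ cong₂ (λ xs ys → ∑ xs f + ∑ ys f) (map-tabulate (Inverse.from A↔) inj₁) (map-tabulate (Inverse.from B↔) inj₂) ⟨
  ∑ (map inj₁ (tabulate (Inverse.from A↔))) f + ∑ (map inj₂ (tabulate (Inverse.from B↔))) f
    ≡⟨ cong₂ _+_ (∑-map inj₁ f (tabulate (Inverse.from A↔))) (∑-map inj₂ f (tabulate (Inverse.from B↔))) ⟩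
  ∑ (tabulate (Inverse.from A↔)) (f ∘ inj₁) + ∑ (tabulate (Inverse.from B↔)) (f ∘ inj₂)
    ∎
  where
  from = Inverse.from (⊎-enumeration A↔ B↔)

  fromˡ : ∀ i → from (i ↑ˡ n) ≡ inj₁ (Inverse.from A↔ i)
  fromˡ i rewrite splitAt-↑ˡ m i n = refl

  fromʳ : ∀ i → from (m ↑ʳ i) ≡ inj₂ (Inverse.from B↔ i)
  fromʳ i rewrite splitAt-↑ʳ m n i = refl

-- Incidence, the handshake lemma and shifted cubes in one graph.

module _ (G : Graph) where
  open Graph G

  deg-∑ : ∀ v → deg v ≡ ∑ vertices (λ w → 𝟙 (Adj? v w))
  deg-∑ v = length-filter-𝟙 (Adj? v) vertices

  length-vertices : length vertices ≡ order
  length-vertices = length-tabulate _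

  ∑-ones : ∑ vertices (λ _ → 1) ≡ order
  ∑-ones = trans (∑-const vertices 1) (trans (*-identityʳ _) length-vertices)

  vertices-unique : Unique vertices
  vertices-unique = tabulate⁺ (Injection.injective (Inverse⇒Injection (↔-sym enumeration)))

  ∈-vertices : ∀ v → v ∈ vertices
  ∈-vertices v = subst (_∈ vertices) (Inverse.strictlyInverseʳ enumeration v) (∈-tabulate⁺ (index v))

  ∑-δᵛ : ∀ v (f : V → ℕ) → ∑ vertices (λ w → 𝟙 (v ≟ᵛ w) * f w) ≡ f v
  ∑-δᵛ v f = ∑-δ _≟ᵛ_ f vertices-unique (∈-vertices v)

  isEdge-irrefl : ∀ {v} → ¬ IsEdge (v , v)
  isEdge-irrefl (v<v , _) = <-irrefl refl v<v

  -- At `p = lookup edges e` this agrees definitionally with `incident? v e`, but it makes sense for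
  -- every pair, edge or not.
  endpoint? : ∀ v (p : V × V) → Dec (v ≡ proj₁ p ⊎ v ≡ proj₂ p)
  endpoint? v (u , w) = (v ≟ᵛ u) ⊎-dec (v ≟ᵛ w)

  -- The two alternatives exclude each other: an edge is listed with strictly increasing indices, so
  -- its endpoints differ.
  endpoint-split : ∀ v {p} → IsEdge p → 𝟙 (endpoint? v p) ≡ 𝟙 (v ≟ᵛ proj₁ p) + 𝟙 (v ≟ᵛ proj₂ p)
  endpoint-split v {u , w} uw = 𝟙-⊎ (v ≟ᵛ u) (v ≟ᵛ w) λ { (refl , refl) → isEdge-irrefl uw }

  -- Trichotomy of the indices decides which orientation is listed. Equal indices would force
  -- `u ≡ v`, and there are no loops.
  adj⇔isEdge : ∀ u v → Adj u v ⇔ (IsEdge (u , v) ⊎ IsEdge (v , u))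
  adj⇔isEdge u v = mk⇔ to λ { (inj₁ (_ , a)) → a ; (inj₂ (_ , a)) → Adj-sym a }
    where
    to : Adj u v → IsEdge (u , v) ⊎ IsEdge (v , u)
    to a with <-cmp (index u) (index v)
    ... | tri< u<v _ _ = inj₁ (u<v , a)
    ... | tri≈ _ u≈v _ = contradiction a (Adj-irrefl (Injection.injective (Inverse⇒Injection enumeration) u≈v))
    ... | tri> _ _ v<u = inj₂ (v<u , Adj-sym a)

  adj-split : ∀ u v → 𝟙 (Adj? u v) ≡ 𝟙 (isEdge? (u , v)) + 𝟙 (isEdge? (v , u))
  adj-split u v = trans
    (𝟙-⇔ (adj⇔isEdge u v) (Adj? u v) (isEdge? (u , v) ⊎-dec isEdge? (v , u)))
    (𝟙-⊎ (isEdge? (u , v)) (isEdge? (v , u)) λ { ((u<v , _) , (v<u , _)) → <-asym u<v v<u })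

  -- Off the edges the factor `𝟙 (isEdge? p)` kills both sides, so the splitting is needed only for
  -- genuine edges. The equality indicators come first on the right to match the delta sums.
  isEdge*endpoint : ∀ v p → 𝟙 (isEdge? p) * 𝟙 (endpoint? v p)
    ≡ 𝟙 (v ≟ᵛ proj₁ p) * 𝟙 (isEdge? p) + 𝟙 (v ≟ᵛ proj₂ p) * 𝟙 (isEdge? p)
  isEdge*endpoint v p = begin
    𝟙 (isEdge? p) * 𝟙 (endpoint? v p)
      ≡⟨ restrict (isEdge? p) ⟩
    𝟙 (isEdge? p) * (𝟙 (v ≟ᵛ proj₁ p) + 𝟙 (v ≟ᵛ proj₂ p))
      ≡⟨ *-comm (𝟙 (isEdge? p)) _ ⟩
    (𝟙 (v ≟ᵛ proj₁ p) + 𝟙 (v ≟ᵛ proj₂ p)) * 𝟙 (isEdge? p)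
      ≡⟨ *-distribʳ-+ (𝟙 (isEdge? p)) (𝟙 (v ≟ᵛ proj₁ p)) _ ⟩
    𝟙 (v ≟ᵛ proj₁ p) * 𝟙 (isEdge? p) + 𝟙 (v ≟ᵛ proj₂ p) * 𝟙 (isEdge? p)
      ∎
    where
    restrict : (e : Dec (IsEdge p)) →
      𝟙 e * 𝟙 (endpoint? v p) ≡ 𝟙 e * (𝟙 (v ≟ᵛ proj₁ p) + 𝟙 (v ≟ᵛ proj₂ p))
    -- `1 * x` reduces to `x + 0`, hence the context `_+ 0`.
    restrict (yes e) = cong (_+ 0) (endpoint-split v e)
    restrict (no _)  = refl

  -- An edge at `v` has `v` either as its first or as its second component. Over all ordered pairs,
  -- the first kind forms the row of `v` and the second its column; together they account for each
  -- neighbour of `v` once.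
  ∑-incident-edges : ∀ v → ∑ (allFin size) (λ e → 𝟙 (incident? v e)) ≡ deg v
  ∑-incident-edges v = begin
    ∑ (allFin size) (λ e → 𝟙 (incident? v e))
      ≡⟨ ∑-lookup edges (λ p → 𝟙 (endpoint? v p)) ⟩
    ∑ edges (λ p → 𝟙 (endpoint? v p))
      ≡⟨ ∑-filter isEdge? (λ p → 𝟙 (endpoint? v p)) (cartesianProduct vertices vertices) ⟩
    ∑ (cartesianProduct vertices vertices) (λ p → 𝟙 (isEdge? p) * 𝟙 (endpoint? v p))
      ≡⟨ ∑-cong (isEdge*endpoint v) (cartesianProduct vertices vertices) ⟩
    ∑ (cartesianProduct vertices vertices) (λ p → 𝟙 (v ≟ᵛ proj₁ p) * 𝟙 (isEdge? p) + 𝟙 (v ≟ᵛ proj₂ p) * 𝟙 (isEdge? p))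
      ≡⟨ ∑-+ _ _ (cartesianProduct vertices vertices) ⟩
    ∑ (cartesianProduct vertices vertices) (λ p → 𝟙 (v ≟ᵛ proj₁ p) * 𝟙 (isEdge? p))
      + ∑ (cartesianProduct vertices vertices) (λ p → 𝟙 (v ≟ᵛ proj₂ p) * 𝟙 (isEdge? p))
      ≡⟨ cong₂ _+_ (∑-cartesianProduct _ vertices vertices) (∑-cartesianProduct _ vertices vertices) ⟩
    ∑ vertices (λ u → ∑ vertices (λ w → 𝟙 (v ≟ᵛ u) * 𝟙 (isEdge? (u , w))))
      + ∑ vertices (λ u → ∑ vertices (λ w → 𝟙 (v ≟ᵛ w) * 𝟙 (isEdge? (u , w))))
      -- In the column part the inner sum collapses at once to `w = v`. In the row part the
      -- indicator does not depend on `w` and is pulled out, so that the outer sum can collapse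
      -- next.
      ≡⟨ cong₂ _+_ (∑-cong (λ u → ∑-*ˡ (𝟙 (v ≟ᵛ u)) (λ w → 𝟙 (isEdge? (u , w))) vertices) vertices)
                   (∑-cong (λ u → ∑-δᵛ v (λ w → 𝟙 (isEdge? (u , w)))) vertices) ⟩
    ∑ vertices (λ u → 𝟙 (v ≟ᵛ u) * ∑ vertices (λ w → 𝟙 (isEdge? (u , w))))
      + ∑ vertices (λ u → 𝟙 (isEdge? (u , v)))
      ≡⟨ cong₂ _+_ (∑-δᵛ v (λ u → ∑ vertices (λ w → 𝟙 (isEdge? (u , w))))) refl ⟩
    ∑ vertices (λ w → 𝟙 (isEdge? (v , w))) + ∑ vertices (λ u → 𝟙 (isEdge? (u , v)))
      ≡⟨ ∑-+ _ _ vertices ⟨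
    ∑ vertices (λ w → 𝟙 (isEdge? (v , w)) + 𝟙 (isEdge? (w , v)))
      ≡⟨ ∑-cong (adj-split v) vertices ⟨
    ∑ vertices (λ w → 𝟙 (Adj? v w))
      ≡⟨ deg-∑ v ⟨
    deg v
      ∎

  -- A delta sum with constant weight 1; the equality test is flipped because `∑-δᵛ` has the fixed
  -- vertex on the left.
  ∑-≟ᵛ : ∀ u → ∑ vertices (λ v → 𝟙 (v ≟ᵛ u)) ≡ 1
  ∑-≟ᵛ u = trans
    (∑-cong (λ v → trans (𝟙-⇔ (mk⇔ sym sym) (v ≟ᵛ u) (u ≟ᵛ v)) (sym (*-identityʳ _))) vertices)
    (∑-δᵛ u (λ _ → 1))

  lookup-isEdge : ∀ e → IsEdge (lookup edges e)
  lookup-isEdge e = All.lookup (all-filter isEdge? (cartesianProduct vertices vertices)) (∈-lookup e)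

  -- Each of the two distinct endpoints contributes 1. This serves both the handshake lemma and the
  -- degree of an inserted vertex.
  ∑-incident-vertices : ∀ e → ∑ vertices (λ v → 𝟙 (incident? v e)) ≡ 2
  ∑-incident-vertices e = begin
    ∑ vertices (λ v → 𝟙 (incident? v e))
      ≡⟨ ∑-cong (λ v → endpoint-split v (lookup-isEdge e)) vertices ⟩
    ∑ vertices (λ v → 𝟙 (v ≟ᵛ proj₁ (lookup edges e)) + 𝟙 (v ≟ᵛ proj₂ (lookup edges e)))
      ≡⟨ ∑-+ _ _ vertices ⟩
    ∑ vertices (λ v → 𝟙 (v ≟ᵛ proj₁ (lookup edges e))) + ∑ vertices (λ v → 𝟙 (v ≟ᵛ proj₂ (lookup edges e)))
      ≡⟨ cong₂ _+_ (∑-≟ᵛ _) (∑-≟ᵛ _) ⟩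
    2 ∎

  -- Double counting of incident vertex-edge pairs: by vertices they give the degrees, by edges they
  -- give 2 each.
  handshake : ∑ vertices deg ≡ size * 2
  handshake = begin
    ∑ vertices deg
      ≡⟨ ∑-cong ∑-incident-edges vertices ⟨
    ∑ vertices (λ v → ∑ (allFin size) (λ e → 𝟙 (incident? v e)))
      ≡⟨ ∑-comm (λ v e → 𝟙 (incident? v e)) vertices (allFin size) ⟩
    ∑ (allFin size) (λ e → ∑ vertices (λ v → 𝟙 (incident? v e)))
      ≡⟨ ∑-cong ∑-incident-vertices (allFin size) ⟩
    ∑ (allFin size) (λ _ → 2)
      ≡⟨ ∑-const (allFin size) 2 ⟩
    length (allFin size) * 2
      ≡⟨ cong (_* 2) (length-allFin size) ⟩
    size * 2 ∎

  -- Joining raises every degree in one graph by the order `k` of the other, so this is applied once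
  -- to each of the two graphs.
  ∑-shifted-cubes : ∀ k → ∑ vertices (λ v → (deg v + k) ^ 3)
    ≡ F G + 3 * k * M₁ G + 3 * k ^ 2 * (size * 2) + order * k ^ 3
  ∑-shifted-cubes k = begin
    ∑ vertices (λ v → (deg v + k) ^ 3)
      ≡⟨ ∑-cong (λ v → cube-expand (deg v) k) vertices ⟩
    ∑ vertices (λ v → deg v ^ 3 + 3 * k * deg v ^ 2 + 3 * k ^ 2 * deg v + k ^ 3)
      ≡⟨ ∑-+ (λ v → deg v ^ 3 + 3 * k * deg v ^ 2 + 3 * k ^ 2 * deg v) (λ _ → k ^ 3) vertices ⟩
    ∑ vertices (λ v → deg v ^ 3 + 3 * k * deg v ^ 2 + 3 * k ^ 2 * deg v) + ∑ vertices (λ _ → k ^ 3)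
      ≡⟨ cong₂ _+_ (∑-+ (λ v → deg v ^ 3 + 3 * k * deg v ^ 2) (λ v → 3 * k ^ 2 * deg v) vertices) refl ⟩
    ∑ vertices (λ v → deg v ^ 3 + 3 * k * deg v ^ 2) + ∑ vertices (λ v → 3 * k ^ 2 * deg v) + ∑ vertices (λ _ → k ^ 3)
      ≡⟨ cong₂ _+_ (cong₂ _+_ (∑-+ (λ v → deg v ^ 3) (λ v → 3 * k * deg v ^ 2) vertices) refl) refl ⟩
    F G + ∑ vertices (λ v → 3 * k * deg v ^ 2) + ∑ vertices (λ v → 3 * k ^ 2 * deg v) + ∑ vertices (λ _ → k ^ 3)
      ≡⟨ cong₂ _+_ (cong₂ (λ s t → F G + s + t) (∑-*ˡ (3 * k) (λ v → deg v ^ 2) vertices) linear) constant ⟩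
    F G + 3 * k * M₁ G + 3 * k ^ 2 * (size * 2) + order * k ^ 3
      ∎
    where
    -- Powers are unfolded because the ring solver does not interpret _^_ on ℕ.
    cube-expand : ∀ d k → (d + k) * ((d + k) * ((d + k) * 1))
      ≡ d * (d * (d * 1)) + 3 * k * (d * (d * 1)) + 3 * (k * (k * 1)) * d + k * (k * (k * 1))
    cube-expand = solve-∀

    linear : ∑ vertices (λ v → 3 * k ^ 2 * deg v) ≡ 3 * k ^ 2 * (size * 2)
    linear = trans (∑-*ˡ (3 * k ^ 2) deg vertices) (cong (3 * k ^ 2 *_) handshake)

    constant : ∑ vertices (λ _ → k ^ 3) ≡ order * k ^ 3
    constant = trans (∑-const vertices (k ^ 3)) (cong (_* k ^ 3) length-vertices)

-- Degrees in the vertex S-join.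

module _ (G₁ G₂ : Graph) where
  private
    module G₁ = Graph G₁
    module G₂ = Graph G₂
    module J  = Graph (vertexSJoin G₁ G₂)

  -- The vertex set is a nested disjoint union, hence two uses of `∑-⊎`. Inserted vertices are
  -- enumerated by the identity, which makes their list `allFin`.
  ∑-vertexSJoin : ∀ (f : J.V → ℕ) → ∑ J.vertices f
    ≡ ∑ G₁.vertices (f ∘ inj₁ ∘ inj₁) + ∑ (allFin G₁.size) (f ∘ inj₁ ∘ inj₂) + ∑ G₂.vertices (f ∘ inj₂)
  ∑-vertexSJoin f = trans
    (∑-⊎ (Graph.enumeration (subdivision G₁)) G₂.enumeration f)
    (cong₂ _+_ (∑-⊎ G₁.enumeration ↔-refl (f ∘ inj₁)) refl)

  ∑-adjacent : ∀ x → J.deg x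
    ≡ ∑ G₁.vertices (λ v → 𝟙 (J.Adj? x (inj₁ (inj₁ v)))) + ∑ (allFin G₁.size) (λ e → 𝟙 (J.Adj? x (inj₁ (inj₂ e))))
      + ∑ G₂.vertices (λ w → 𝟙 (J.Adj? x (inj₂ w)))
  ∑-adjacent x = trans (deg-∑ (vertexSJoin G₁ G₂) x) (∑-vertexSJoin (λ y → 𝟙 (J.Adj? x y)))

  -- In each block `joinAdj?` computes: no neighbour among the original vertices, one for every edge
  -- at `v`, and all of `G₂`.
  deg-original : ∀ v → J.deg (inj₁ (inj₁ v)) ≡ G₁.deg v + G₂.order
  deg-original v = trans (∑-adjacent (inj₁ (inj₁ v)))
    (cong₂ _+_ (cong₂ _+_ (∑-zero G₁.vertices) (∑-incident-edges G₁ v)) (∑-ones G₂))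

  -- Only the block of original vertices contributes, namely the two endpoints of the subdivided
  -- edge.
  deg-inserted : ∀ e → J.deg (inj₁ (inj₂ e)) ≡ 2
  deg-inserted e = trans (∑-adjacent (inj₁ (inj₂ e)))
    (cong₂ _+_ (cong₂ _+_ (∑-incident-vertices G₁ e) (∑-zero (allFin G₁.size))) (∑-zero G₂.vertices))

  deg-joined : ∀ w → J.deg (inj₂ w) ≡ G₂.deg w + G₁.order
  deg-joined w = begin
    J.deg (inj₂ w)
      ≡⟨ ∑-adjacent (inj₂ w) ⟩
    ∑ G₁.vertices (λ _ → 1) + ∑ (allFin G₁.size) (λ _ → 0) + ∑ G₂.vertices (λ x → 𝟙 (G₂.Adj? w x))
      ≡⟨ cong₂ _+_ (cong₂ _+_ (∑-ones G₁) (∑-zero (allFin G₁.size))) (sym (deg-∑ G₂ w)) ⟩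
    G₁.order + 0 + G₂.deg w
      ≡⟨ cong (_+ G₂.deg w) (+-identityʳ G₁.order) ⟩
    G₁.order + G₂.deg w
      ≡⟨ +-comm G₁.order (G₂.deg w) ⟩
    G₂.deg w + G₁.order
      ∎

  ∑-inserted-cubes : ∑ (allFin G₁.size) (λ e → J.deg (inj₁ (inj₂ e)) ^ 3) ≡ G₁.size * 8
  ∑-inserted-cubes = begin
    ∑ (allFin G₁.size) (λ e → J.deg (inj₁ (inj₂ e)) ^ 3)  ≡⟨ ∑-cong (λ e → cong (_^ 3) (deg-inserted e)) (allFin G₁.size) ⟩
    ∑ (allFin G₁.size) (λ _ → 8)                          ≡⟨ ∑-const (allFin G₁.size) 8 ⟩
    length (allFin G₁.size) * 8                           ≡⟨ cong (_* 8) (length-allFin G₁.size) ⟩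
    G₁.size * 8                                           ∎

theorem1 : (G₁ G₂ : Graph) → Connected G₁ → Connected G₂ →
    (n₁ n₂ m₁ m₂ : ℕ) →
    Graph.order G₁ ≡ n₁ → Graph.order G₂ ≡ n₂ →
    Graph.size G₁ ≡ m₁ → Graph.size G₂ ≡ m₂ →
    F (vertexSJoin G₁ G₂) ≡
    F G₁ + F G₂ + 3 * n₂ * M₁ G₁ + 3 * n₁ * M₁ G₂
    + 6 * m₁ * n₂ ^ 2 + 6 * m₂ * n₁ ^ 2
    + n₁ * n₂ * (n₁ ^ 2 + n₂ ^ 2) + 8 * m₁
theorem1 G₁ G₂ _ _ n₁ n₂ m₁ m₂ refl refl refl refl = begin
  F (vertexSJoin G₁ G₂)
    ≡⟨ ∑-vertexSJoin G₁ G₂ (λ x → J.deg x ^ 3) ⟩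
  ∑ G₁.vertices (λ v → J.deg (inj₁ (inj₁ v)) ^ 3) + ∑ (allFin m₁) (λ e → J.deg (inj₁ (inj₂ e)) ^ 3)
    + ∑ G₂.vertices (λ w → J.deg (inj₂ w) ^ 3)
    ≡⟨ cong₂ _+_ (cong₂ _+_ (∑-cong (λ v → cong (_^ 3) (deg-original G₁ G₂ v)) G₁.vertices)
                            (∑-inserted-cubes G₁ G₂))
                 (∑-cong (λ w → cong (_^ 3) (deg-joined G₁ G₂ w)) G₂.vertices) ⟩
  ∑ G₁.vertices (λ v → (G₁.deg v + n₂) ^ 3) + m₁ * 8 + ∑ G₂.vertices (λ w → (G₂.deg w + n₁) ^ 3)
    ≡⟨ cong₂ (λ s t → s + m₁ * 8 + t) (∑-shifted-cubes G₁ n₂) (∑-shifted-cubes G₂ n₁) ⟩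
  F G₁ + 3 * n₂ * M₁ G₁ + 3 * n₂ ^ 2 * (m₁ * 2) + n₁ * n₂ ^ 3 + m₁ * 8
    + (F G₂ + 3 * n₁ * M₁ G₂ + 3 * n₁ ^ 2 * (m₂ * 2) + n₂ * n₁ ^ 3)
    -- The handshake factors 2 turn the coefficients 3 into 6, and `n₁ * n₂ ^ 3 + n₂ * n₁ ^ 3`
    -- factors as `n₁ * n₂ * (n₁ ^ 2 + n₂ ^ 2)`.
    ≡⟨ collect (F G₁) (F G₂) (M₁ G₁) (M₁ G₂) n₁ n₂ m₁ m₂ ⟩
  F G₁ + F G₂ + 3 * n₂ * M₁ G₁ + 3 * n₁ * M₁ G₂
    + 6 * m₁ * n₂ ^ 2 + 6 * m₂ * n₁ ^ 2
    + n₁ * n₂ * (n₁ ^ 2 + n₂ ^ 2) + 8 * m₁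
    ∎
  where
  module G₁ = Graph G₁
  module G₂ = Graph G₂
  module J  = Graph (vertexSJoin G₁ G₂)

  -- The products ending in `* 1` are the normal forms of the powers, so this identity fits the
  -- chain above definitionally.
  collect : ∀ f₁ f₂ z₁ z₂ n₁ n₂ m₁ m₂ →
    f₁ + 3 * n₂ * z₁ + 3 * (n₂ * (n₂ * 1)) * (m₁ * 2) + n₁ * (n₂ * (n₂ * (n₂ * 1))) + m₁ * 8
      + (f₂ + 3 * n₁ * z₂ + 3 * (n₁ * (n₁ * 1)) * (m₂ * 2) + n₂ * (n₁ * (n₁ * (n₁ * 1))))
    ≡ f₁ + f₂ + 3 * n₂ * z₁ + 3 * n₁ * z₂
      + 6 * m₁ * (n₂ * (n₂ * 1)) + 6 * m₂ * (n₁ * (n₁ * 1))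
      + n₁ * n₂ * (n₁ * (n₁ * 1) + n₂ * (n₂ * 1)) + 8 * m₁
  collect = solve-∀
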